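{- There is no graph $G$ that is $P_4$-induced-saturated, and there is no graph $G$ that is $\{P_4, C_4\}$-induced-saturated.
   Context: All graphs are finite and simple. $P_4$ and $C_4$ denote the path and the cycle on $4$ vertices. For a family $\mathcal{F}$ of graphs, a graph $G$ is $\mathcal{F}$-induced-saturated if $G$ contains no induced subgraph isomorphic to a member of $\mathcal{F}$, but deleting any edge of $G$, or adding to $G$ any edge of its complement $\overline{G}$, results in a graph that contains an induced subgraph isomorphic to a member of $\mathcal{F}$. For $\mathcal{F}=\{H\}$ we say $H$-induced-saturated.
   Formalization: Graphs are required to have at least two vertices, since graphs with at most one vertex have no edge to delete or add and contain no P_4 or C_4, so they are vacuously induced-saturated and the literal claim fails for them. -}

module Defs where

open import Data.Fin using (Fin; #_; toℕ)
open import Data.Fin.Properties using () renaming (_≟_ to _≟ꟳ_)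
open import Data.Fin.Subset using (Subset; _∈_)
open import Data.Nat using (ℕ; suc; _≟_)
open import Data.Nat.Properties using (1+n≢n)
open import Data.Product using (∃-syntax; Σ-syntax; _×_; _,_; proj₁; proj₂)
open import Data.Sum using (_⊎_; inj₁; inj₂; swap)
open import Function.Bundles using (_↔_; _⇔_; module Inverse)
open import Level using (0ℓ) renaming (suc to lsuc)
open import Relation.Binary using (Rel; Symmetric; Irreflexive; Decidable)
open import Relation.Binary.PropositionalEquality using (_≡_; _≢_; refl; sym; trans; cong)
open import Relation.Nullary using (¬_)
open import Relation.Nullary.Decidable using (_×-dec_; _⊎-dec_; ¬?)
open import Relation.Unary using (Pred; ｛_｝; _∪_)

record Graph (V : Set) : Set₁ where
  field
    Adj        : Rel V 0ℓ
    adj?       : Decidable Adj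
    adj-sym    : Symmetric Adj
    adj-irrefl : Irreflexive _≡_ Adj

open Graph

FiniteGraph : Set₁
FiniteGraph = ∃[ n ] Graph (Fin n)

infix 4 _≅_

_≅_ : {V W : Set} → Graph V → Graph W → Set
_≅_ {V} {W} G H =
  Σ[ φ ∈ V ↔ W ] (∀ x y → Adj G x y ⇔ Adj H (Inverse.to φ x) (Inverse.to φ y))

induced : ∀ {n} → Graph (Fin n) → (S : Subset n) → Graph (∃[ v ] v ∈ S)
induced G S .Adj (x , _) (y , _)  = Adj G x y
induced G S .adj? (x , _) (y , _) = adj? G x y
induced G S .adj-sym              = adj-sym G
induced G S .adj-irrefl p         = adj-irrefl G (cong proj₁ p)

complement : ∀ {n} → Graph (Fin n) → Graph (Fin n)
complement G .Adj x y                  = x ≢ y × ¬ Adj G x y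
complement G .adj? x y                 = ¬? (x ≟ꟳ y) ×-dec ¬? (adj? G x y)
complement G .adj-sym (x≢y , ¬xy)      = (λ p → x≢y (sym p)) , (λ yx → ¬xy (adj-sym G yx))
complement G .adj-irrefl x≡y (x≢y , _) = x≢y x≡y

-- {x , y} = {u , v} as unordered pairs.
SamePair : ∀ {n} → Fin n → Fin n → Rel (Fin n) 0ℓ
SamePair u v x y = (x ≡ u × y ≡ v) ⊎ (x ≡ v × y ≡ u)

samePair? : ∀ {n} (u v : Fin n) → Decidable (SamePair u v)
samePair? u v x y = ((x ≟ꟳ u) ×-dec (y ≟ꟳ v)) ⊎-dec ((x ≟ꟳ v) ×-dec (y ≟ꟳ u))

samePair-sym : ∀ {n} (u v : Fin n) → Symmetric (SamePair u v)
samePair-sym u v (inj₁ (p , q)) = inj₂ (q , p)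
samePair-sym u v (inj₂ (p , q)) = inj₁ (q , p)

deleteEdge : ∀ {n} → Graph (Fin n) → (u v : Fin n) → Graph (Fin n)
deleteEdge G u v .Adj x y               = Adj G x y × ¬ SamePair u v x y
deleteEdge G u v .adj? x y              = adj? G x y ×-dec ¬? (samePair? u v x y)
deleteEdge G u v .adj-sym (xy , ¬s)     = adj-sym G xy , λ s → ¬s (samePair-sym u v s)
deleteEdge G u v .adj-irrefl p (xy , _) = adj-irrefl G p xy

addEdge : ∀ {n} → Graph (Fin n) → (u v : Fin n) → u ≢ v → Graph (Fin n)
addEdge G u v u≢v .Adj x y                                = Adj G x y ⊎ SamePair u v x y
addEdge G u v u≢v .adj? x y                               = adj? G x y ⊎-dec samePair? u v x y
addEdge G u v u≢v .adj-sym (inj₁ xy)                      = inj₁ (adj-sym G xy)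
addEdge G u v u≢v .adj-sym (inj₂ s)                       = inj₂ (samePair-sym u v s)
addEdge G u v u≢v .adj-irrefl p (inj₁ xy)                 = adj-irrefl G p xy
addEdge G u v u≢v .adj-irrefl refl (inj₂ (inj₁ (p , q)))  = u≢v (trans (sym p) q)
addEdge G u v u≢v .adj-irrefl refl (inj₂ (inj₂ (p , q)))  = u≢v (trans (sym q) p)

path : (n : ℕ) → Graph (Fin n)
path n .Adj i j                 = toℕ j ≡ suc (toℕ i) ⊎ toℕ i ≡ suc (toℕ j)
path n .adj? i j                = (toℕ j ≟ suc (toℕ i)) ⊎-dec (toℕ i ≟ suc (toℕ j))
path n .adj-sym                 = swap
path n .adj-irrefl refl (inj₁ p) = 1+n≢n (sym p)
path n .adj-irrefl refl (inj₂ p) = 1+n≢n (sym p)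

P₄ : FiniteGraph
P₄ = 4 , path 4

-- The cycle closes the path 0 – 1 – 2 – 3 with an edge between its ends.
C₄ : FiniteGraph
C₄ = 4 , addEdge (path 4) (# 0) (# 3) (λ ())

Family : Set₂
Family = Pred FiniteGraph (lsuc 0ℓ)

ContainsInduced : ∀ {n} → Family → Graph (Fin n) → Set₁
ContainsInduced {n} 𝓕 G =
  Σ[ S ∈ Subset n ] Σ[ H ∈ FiniteGraph ] (𝓕 H × induced G S ≅ proj₂ H)

-- Graphs on at most one vertex have neither edges nor non-edges, so for them
-- both universally quantified conditions are vacuous: they are 𝓕-induced-saturated
-- as soon as they contain no member of 𝓕.
InducedSaturated : ∀ {n} → Family → Graph (Fin n) → Set₁
InducedSaturated 𝓕 G =
    ¬ ContainsInduced 𝓕 G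
  × (∀ u v → Adj G u v → ContainsInduced 𝓕 (deleteEdge G u v))
  × (∀ u v → (e : Adj (complement G) u v) → ContainsInduced 𝓕 (addEdge G u v (proj₁ e)))

⟨P₄⟩ : Family
⟨P₄⟩ = ｛ P₄ ｝

⟨P₄,C₄⟩ : Family
⟨P₄,C₄⟩ = ｛ P₄ ｝ ∪ ｛ C₄ ｝

{-# OPTIONS --safe #-}
-- Every P₄-free graph on at least two vertices has twins u, v, and switching the
-- pair uv between edge and non-edge leaves it P₄-free, because no two vertices
-- of P₄ are twins.  The twins come from the fact that a P₄-free graph or its
-- complement is disconnected: recurse into a side with at least two vertices.
--
-- A graph is {P₄, C₄}-free iff the closed neighbourhoods of the ends of every
-- edge are nested.  Let N[u] be minimal under inclusion, so that N[u] is a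
-- clique.  If some neighbour v of u has N[v] = N[u], deleting uv creates neither
-- P₄ nor C₄.  Otherwise some non-neighbour y ≠ u satisfies N(u) ⊆ N(y); taking y
-- with N[y] maximal, adding uy keeps all closed neighbourhoods nested.
module Submission where

open import Defs
open import Data.Empty using (⊥; ⊥-elim)
open import Data.Fin using (Fin; zero; suc; #_; _<_)
open import Data.Fin.Induction using (spo-wellFounded)
open import Data.Fin.Properties using (_≟_; <-cmp; any?; all?; ¬∀⟶∃¬)
open import Data.Fin.Subset using (Subset; _∈_)
open import Data.List using (List; []; _∷_; filter; length)
open import Data.List.Membership.Propositional using (find; lose) renaming (_∈_ to _∈ˡ_)
open import Data.List.Membership.Propositional.Properties using (∈-filter⁺; ∈-filter⁻; ∈-allFin)
open import Data.List.Properties using (filter-notAll)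
open import Data.List.Relation.Unary.All as All using ()
open import Data.List.Relation.Unary.AllPairs using (_∷_)
open import Data.List.Relation.Unary.Any as Any using (here; there)
open import Data.List.Relation.Unary.Unique.Propositional using (Unique)
open import Data.List.Relation.Unary.Unique.Propositional.Properties using (filter⁺; allFin⁺)
open import Data.Nat using (ℕ; 2+; _+_; _≤_; s≤s) renaming (_<_ to _<ᴺ_)
open import Data.Nat.Induction using (<-wellFounded)
open import Data.Product using (∃-syntax; _×_; _,_; proj₁; proj₂)
open import Data.Sum as Sum using (_⊎_; inj₁; inj₂)
open import Data.Unit using (⊤; tt)
open import Data.Vec using ([]; _∷_; lookup; tabulate)
open import Data.Vec.Properties using (lookup∘tabulate; []=⇒lookup; lookup⇒[]=)
open import Data.Vec.Properties.WithK using ([]=-irrelevant)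
open import Function using (_∘_; id; flip)
open import Function.Bundles using (_⇔_; mk⇔; mk↔ₛ′; module Equivalence; module Inverse)
open import Induction.WellFounded using (Acc; acc)
open import Relation.Binary using (Rel; Transitive; IsStrictPartialOrder; tri<; tri≈; tri>)
  renaming (Decidable to Decidable₂)
open import Relation.Binary.PropositionalEquality
  using (_≡_; _≢_; refl; sym; trans; cong; subst; subst₂; isEquivalence; ≢-sym)
open import Relation.Nullary using (¬_; yes; no; contradiction)
open import Relation.Nullary.Decidable
  using (True; does; ¬?; _×-dec_; _⊎-dec_; _→-dec_; decidable-stable; dec-true; toWitness)
open import Relation.Unary using (Decidable)
open import Level using (0ℓ)

open Graph
open Equivalence using (to; from)

-- Non-adjacency of distinct vertices

NonAdj : ∀ {n} → Graph (Fin n) → Rel (Fin n) 0ℓ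
NonAdj G = Adj (complement G)

module _ {n} (G : Graph (Fin n)) where

  nonAdj-sym : ∀ {x y} → NonAdj G x y → NonAdj G y x
  nonAdj-sym = adj-sym (complement G)

  adj⇒≢ : ∀ {x y} → Adj G x y → x ≢ y
  adj⇒≢ xy x≡y = adj-irrefl G x≡y xy

  ¬nonAdj⇒adj : ∀ {x y} → x ≢ y → ¬ NonAdj G x y → Adj G x y
  ¬nonAdj⇒adj {x} {y} x≢y h = decidable-stable (adj? G x y) (λ ¬xy → h (x≢y , ¬xy))

  complement²⇒adj : ∀ {x y} → NonAdj (complement G) x y → Adj G x y
  complement²⇒adj (x≢y , h) = ¬nonAdj⇒adj x≢y h

  adj⇒complement² : ∀ {x y} → Adj G x y → NonAdj (complement G) x y
  adj⇒complement² xy = adj⇒≢ xy , λ (_ , ¬xy) → ¬xy xy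

  adj-or-nonAdj : ∀ {x y} → x ≢ y → Adj G x y ⊎ NonAdj G x y
  adj-or-nonAdj {x} {y} x≢y with adj? G x y
  ... | yes xy = inj₁ xy
  ... | no ¬xy = inj₂ (x≢y , ¬xy)

-- Induced subgraphs as embeddings

-- An induced copy given by a vertex map rather than a vertex set, so that the vertices of the copy
-- can be named one by one.
record Embedding {k n} (H : Graph (Fin k)) (G : Graph (Fin n)) : Set where
  field
    vertex    : Fin k → Fin n
    injective : ∀ {i j} → vertex i ≡ vertex j → i ≡ j
    adj⇔      : ∀ i j → Adj H i j ⇔ Adj G (vertex i) (vertex j)

  edge : ∀ i j {_ : True (adj? H i j)} → Adj G (vertex i) (vertex j)
  edge i j {t} = to (adj⇔ i j) (toWitness t)

  nonEdge : ∀ i j {_ : True (adj? (complement H) i j)} → NonAdj G (vertex i) (vertex j)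
  nonEdge i j {t} = let i≢j , ¬ij = toWitness t in i≢j ∘ injective , ¬ij ∘ from (adj⇔ i j)

induced⇒embedding : ∀ {k n} {H : Graph (Fin k)} {G : Graph (Fin n)} {S} →
                    induced G S ≅ H → Embedding H G
induced⇒embedding {H = H} {G} {S} (φ , h) = record
  { vertex    = proj₁ ∘ Inverse.from φ
  ; injective = λ {i} {j} eq → trans (sym (section i)) (trans (cong (Inverse.to φ) (Σ-≡ eq)) (section j))
  ; adj⇔      = λ i j → mk⇔
      (λ ij → from (h _ _) (subst₂ (Adj H) (sym (section i)) (sym (section j)) ij))
      (λ ij → subst₂ (Adj H) (section i) (section j) (to (h _ _) ij))
  }
  where
  section : ∀ i → Inverse.to φ (Inverse.from φ i) ≡ i
  section = Inverse.strictlyInverseˡ φ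

  Σ-≡ : {x y : ∃[ v ] v ∈ S} → proj₁ x ≡ proj₁ y → x ≡ y
  Σ-≡ {v , p} {.v , q} refl = cong (v ,_) ([]=-irrelevant p q)

embedding⇒induced : ∀ {k n} {H : Graph (Fin k)} {G : Graph (Fin n)} →
                    Embedding H G → ∃[ S ] induced G S ≅ H
embedding⇒induced {k} {n} {H} {G} e = S , mk↔ₛ′ index member index-member member-index , adj
  where
  open Embedding e

  image? : Decidable (λ v → ∃[ i ] vertex i ≡ v)
  image? v = any? (λ i → vertex i ≟ v)

  S : Subset n
  S = tabulate (does ∘ image?)

  preimage : ∀ {v} → v ∈ S → ∃[ i ] vertex i ≡ v
  preimage {v} v∈S with image? v in eq
  ... | yes p = p
  ... | no  _
    with () ← trans (sym (trans (sym (lookup∘tabulate (does ∘ image?) v)) ([]=⇒lookup v∈S))) (cong does eq)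

  member : Fin k → ∃[ v ] v ∈ S
  member i = vertex i , lookup⇒[]= (vertex i) S
    (trans (lookup∘tabulate (does ∘ image?) (vertex i)) (dec-true (image? (vertex i)) (i , refl)))

  index : ∃[ v ] v ∈ S → Fin k
  index (_ , v∈S) = proj₁ (preimage v∈S)

  vertex-index : ∀ x → vertex (index x) ≡ proj₁ x
  vertex-index (_ , v∈S) = proj₂ (preimage v∈S)

  index-member : ∀ i → index (member i) ≡ i
  index-member i = injective (vertex-index (member i))

  member-index : ∀ x → member (index x) ≡ x
  member-index x@(v , v∈S) with index x | vertex-index x
  ... | i | refl = cong (vertex i ,_) ([]=-irrelevant _ v∈S)

  adj : ∀ x y → Adj (induced G S) x y ⇔ Adj H (index x) (index y)
  adj x y = mk⇔
    (λ xy → from (adj⇔ _ _) (subst₂ (Adj G) (sym (vertex-index x)) (sym (vertex-index y)) xy))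
    (λ ij → subst₂ (Adj G) (vertex-index x) (vertex-index y) (to (adj⇔ _ _) ij))

-- Induced P₄ and C₄

-- Both alternatives force `i ≢ j` and `x ≢ y`, so agreement on every pair yields injectivity as
-- well as preservation of adjacency.
Agree : ∀ {k n} → Graph (Fin k) → Graph (Fin n) → Fin k → Fin k → Fin n → Fin n → Set
Agree H G i j x y = (Adj H i j × Adj G x y) ⊎ (NonAdj H i j × NonAdj G x y)

module _ {n} {H : Graph (Fin 4)} {G : Graph (Fin n)} where

  embed₄ : ∀ {a b c d} →
           Agree H G (# 0) (# 1) a b → Agree H G (# 1) (# 2) b c → Agree H G (# 2) (# 3) c d →
           Agree H G (# 0) (# 2) a c → Agree H G (# 1) (# 3) b d → Agree H G (# 0) (# 3) a d →
           Embedding H G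
  embed₄ {a} {b} {c} {d} ab bc cd ac bd ad = record
    { vertex = f ; injective = λ {i} {j} → inj i j ; adj⇔ = iff }
    where
    f : Fin 4 → Fin n
    f = lookup (a ∷ b ∷ c ∷ d ∷ [])

    agree : ∀ i j → i < j → Agree H G i j (f i) (f j)
    agree zero             (suc zero)             _ = ab
    agree zero             (suc (suc zero))       _ = ac
    agree zero             (suc (suc (suc zero))) _ = ad
    agree (suc zero)       (suc (suc zero))       _ = bc
    agree (suc zero)       (suc (suc (suc zero))) _ = bd
    agree (suc (suc zero)) (suc (suc (suc zero))) _ = cd
    agree (suc zero)             (suc zero)             (s≤s ())
    agree (suc (suc zero))       (suc zero)             (s≤s ())
    agree (suc (suc zero))       (suc (suc zero))       (s≤s (s≤s ()))
    agree (suc (suc (suc zero))) (suc zero)             (s≤s ())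
    agree (suc (suc (suc zero))) (suc (suc zero))       (s≤s (s≤s ()))
    agree (suc (suc (suc zero))) (suc (suc (suc zero))) (s≤s (s≤s (s≤s ())))

    agree-sym : ∀ {i j x y} → Agree H G i j x y → Agree H G j i y x
    agree-sym (inj₁ (p , q)) = inj₁ (adj-sym H p , adj-sym G q)
    agree-sym (inj₂ (p , q)) = inj₂ (nonAdj-sym H p , nonAdj-sym G q)

    agree⇒≢ : ∀ {i j x y} → Agree H G i j x y → x ≢ y
    agree⇒≢ (inj₁ (_ , q)) = adj⇒≢ G q
    agree⇒≢ (inj₂ (_ , q)) = proj₁ q

    agree⇒⇔ : ∀ {i j x y} → Agree H G i j x y → Adj H i j ⇔ Adj G x y
    agree⇒⇔ (inj₁ (p , q)) = mk⇔ (λ _ → q) (λ _ → p)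
    agree⇒⇔ (inj₂ (p , q)) = mk⇔ (λ e → contradiction e (proj₂ p)) (λ e → contradiction e (proj₂ q))

    inj : ∀ i j → f i ≡ f j → i ≡ j
    inj i j eq with <-cmp i j
    ... | tri< i<j _ _ = contradiction eq (agree⇒≢ (agree i j i<j))
    ... | tri≈ _ i≡j _ = i≡j
    ... | tri> _ _ j<i = contradiction (sym eq) (agree⇒≢ (agree j i j<i))

    iff : ∀ i j → Adj H i j ⇔ Adj G (f i) (f j)
    iff i j with <-cmp i j
    ... | tri< i<j _ _  = agree⇒⇔ (agree i j i<j)
    ... | tri≈ _ refl _ = mk⇔ (⊥-elim ∘ adj-irrefl H refl) (⊥-elim ∘ adj-irrefl G refl)
    ... | tri> _ _ j<i  = agree⇒⇔ (agree-sym (agree j i j<i))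

module _ {k n} (H : Graph (Fin k)) (G : Graph (Fin n)) where

  agree-edge : ∀ i j {x y} {_ : True (adj? H i j)} → Adj G x y → Agree H G i j x y
  agree-edge i j {_} {_} {t} xy = inj₁ (toWitness t , xy)

  agree-nonEdge : ∀ i j {x y} {_ : True (adj? (complement H) i j)} → NonAdj G x y → Agree H G i j x y
  agree-nonEdge i j {_} {_} {t} xy = inj₂ (toWitness t , xy)

P₄-Free : ∀ {n} → Graph (Fin n) → Set
P₄-Free G = ∀ {a b c d} → Adj G a b → Adj G b c → Adj G c d →
            NonAdj G a c → NonAdj G b d → NonAdj G a d → ⊥

-- The pair ad is unconstrained, so the forbidden pattern is P₄ or C₄.
P₄C₄-Free : ∀ {n} → Graph (Fin n) → Set
P₄C₄-Free G = ∀ {a b c d} → Adj G a b → Adj G b c → Adj G c d →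
              NonAdj G a c → NonAdj G b d → ⊥

module _ {n} {G : Graph (Fin n)} where

  ¬contains⇒P₄-Free : ∀ {𝓕 : Family} → 𝓕 P₄ → ¬ ContainsInduced 𝓕 G → P₄-Free G
  ¬contains⇒P₄-Free P₄∈𝓕 free ab bc cd ac bd ad =
    let S , iso = embedding⇒induced (embed₄ {H = path 4} {G}
                    (e (# 0) (# 1) ab) (e (# 1) (# 2) bc) (e (# 2) (# 3) cd)
                    (ne (# 0) (# 2) ac) (ne (# 1) (# 3) bd) (ne (# 0) (# 3) ad))
    in free (S , P₄ , P₄∈𝓕 , iso)
    where
    e  = agree-edge (path 4) G
    ne = agree-nonEdge (path 4) G

  ¬contains⇒P₄C₄-Free : ¬ ContainsInduced ⟨P₄,C₄⟩ G → P₄C₄-Free G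
  ¬contains⇒P₄C₄-Free free {a} {b} {c} {d} ab bc cd ac bd
    -- `a` and `d` differ: otherwise the edge `cd` would contradict the non-edge `ac`.
    with adj-or-nonAdj G {a} {d} (λ { refl → proj₂ ac (adj-sym G cd) })
  ... | inj₂ ad = ¬contains⇒P₄-Free {𝓕 = ⟨P₄,C₄⟩} (inj₁ refl) free ab bc cd ac bd ad
  ... | inj₁ ad =
    let S , iso = embedding⇒induced (embed₄ {H = proj₂ C₄} {G}
                    (e (# 0) (# 1) ab) (e (# 1) (# 2) bc) (e (# 2) (# 3) cd)
                    (ne (# 0) (# 2) ac) (ne (# 1) (# 3) bd) (e (# 0) (# 3) ad))
    in free (S , C₄ , inj₂ refl , iso)
    where
    e  = agree-edge (proj₂ C₄) G
    ne = agree-nonEdge (proj₂ C₄) G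

  P₄-Free⇒¬contains : P₄-Free G → ¬ ContainsInduced ⟨P₄⟩ G
  P₄-Free⇒¬contains free (_ , _ , refl , iso) = free
    (edge (# 0) (# 1)) (edge (# 1) (# 2)) (edge (# 2) (# 3))
    (nonEdge (# 0) (# 2)) (nonEdge (# 1) (# 3)) (nonEdge (# 0) (# 3))
    where open Embedding (induced⇒embedding {H = path 4} {G} iso)

  P₄C₄-Free⇒¬contains : P₄C₄-Free G → ¬ ContainsInduced ⟨P₄,C₄⟩ G
  P₄C₄-Free⇒¬contains free (S , H , inj₁ P₄≡H , iso) =
    P₄-Free⇒¬contains (λ ab bc cd ac bd _ → free ab bc cd ac bd) (S , H , P₄≡H , iso)
  P₄C₄-Free⇒¬contains free (_ , _ , inj₂ refl , iso) = free
    (edge (# 0) (# 1)) (edge (# 1) (# 2)) (edge (# 2) (# 3))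
    (nonEdge (# 0) (# 2)) (nonEdge (# 1) (# 3))
    where open Embedding (induced⇒embedding {H = proj₂ C₄} {G} iso)

-- `P₄` is self-complementary: an induced path a - b - c - d of the complement is the induced path b
-- - d - a - c of `G`.
complement-P₄-Free : ∀ {n} {G : Graph (Fin n)} → P₄-Free G → P₄-Free (complement G)
complement-P₄-Free {G = G} free ab bc cd ac bd ad =
  free (complement²⇒adj G bd) (adj-sym G (complement²⇒adj G ad)) (complement²⇒adj G ac)
       (nonAdj-sym G ab) (nonAdj-sym G cd) bc

-- Twins in P₄-free graphs

-- A join decomposition of the subgraph induced on `S`. Over `complement G` the same record says
-- that this subgraph of `G` is disconnected.
record Split {n} (G : Graph (Fin n)) (S : List (Fin n)) : Set₁ where
  field
    Side        : Fin n → Set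
    side?       : Decidable Side
    left right  : Fin n
    left∈       : left ∈ˡ S
    right∈      : right ∈ˡ S
    left-side   : Side left
    right-¬side : ¬ Side right
    cross       : ∀ {y z} → y ∈ˡ S → z ∈ˡ S → Side y → ¬ Side z → Adj G y z

module _ {n} {S : List (Fin n)} where

  open Split

  map-split : ∀ {G H : Graph (Fin n)} → (∀ {x y} → Adj G x y → Adj H x y) → Split G S → Split H S
  map-split h s = record
    { Split s hiding (cross)
    ; cross = λ y∈ z∈ y-side z-¬side → h (cross s y∈ z∈ y-side z-¬side)
    }

  swap-split : ∀ {G : Graph (Fin n)} → Split G S → Split G S
  swap-split {G} s = record
    { Side        = ¬_ ∘ Side s
    ; side?       = ¬? ∘ side? s
    ; left        = right s
    ; right       = left s
    ; left∈       = right∈ s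
    ; right∈      = left∈ s
    ; left-side   = right-¬side s
    ; right-¬side = λ ¬left → ¬left (left-side s)
    ; cross       = λ y∈ z∈ y-¬side z-side →
        adj-sym G (cross s z∈ y∈ (decidable-stable (side? s _) z-side) y-¬side)
    }

  cone-split : ∀ {G : Graph (Fin n)} {x y} → y ∈ˡ S → (∀ {z} → z ∈ˡ S → Adj G x z) → Split G (x ∷ S)
  cone-split {G} {x} {y} y∈ x-adj = record
    { Side        = _≡ x
    ; side?       = _≟ x
    ; left        = x
    ; right       = y
    ; left∈       = here refl
    ; right∈      = there y∈
    ; left-side   = refl
    ; right-¬side = ≢-sym (adj⇒≢ G (x-adj y∈))
    ; cross       = λ { _ (here z≡x)  _    z≢x → contradiction z≡x z≢x
                      ; _ (there z∈)  refl _   → x-adj z∈ }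
    }

  -- If x has no neighbour on the other side, x can join the side of a.  Otherwise
  -- the non-neighbours of x on the side of a are cut off from everything else.
  extend-disconnection : ∀ {G : Graph (Fin n)} {x a} → P₄-Free G → (∀ {y} → y ∈ˡ S → x ≢ y) →
                         (s : Split (complement G) S) → a ∈ˡ S → Side s a → NonAdj G x a →
                         Split (complement G) (x ∷ S)
  extend-disconnection {G} {x} {a} free x∉ s a∈ a-side xa
    with Any.any? (λ b → ¬? (side? s b) ×-dec adj? G x b) S
  ... | no none = record
    { Side        = λ y → Side s y ⊎ y ≡ x
    ; side?       = λ y → side? s y ⊎-dec (y ≟ x)
    ; left        = a
    ; right       = right s
    ; left∈       = there a∈
    ; right∈      = there (right∈ s)
    ; left-side   = inj₁ a-side
    ; right-¬side = Sum.[ right-¬side s , ≢-sym (x∉ (right∈ s)) ]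
    ; cross       = across
    }
    where
    across : ∀ {y z} → y ∈ˡ (x ∷ S) → z ∈ˡ (x ∷ S) →
             Side s y ⊎ y ≡ x → ¬ (Side s z ⊎ z ≡ x) → NonAdj G y z
    across _          (here z≡x) _             ¬z = contradiction (inj₂ z≡x) ¬z
    across _          (there z∈) (inj₂ refl)   ¬z = x∉ z∈ , λ xz → none (lose z∈ (¬z ∘ inj₁ , xz))
    across (here refl) (there z∈) (inj₁ _)     ¬z = x∉ z∈ , λ xz → none (lose z∈ (¬z ∘ inj₁ , xz))
    across (there y∈) (there z∈) (inj₁ y-side) ¬z = cross s y∈ z∈ y-side (¬z ∘ inj₁)
  ... | yes some with find some
  ... | b , b∈ , b-¬side , xb = record
    { Side        = λ y → Side s y × NonAdj G x y
    ; side?       = λ y → side? s y ×-dec adj? (complement G) x y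
    ; left        = a
    ; right       = x
    ; left∈       = there a∈
    ; right∈      = here refl
    ; left-side   = a-side , xa
    ; right-¬side = λ (_ , xx) → proj₁ xx refl
    ; cross       = across
    }
    where
    across : ∀ {y z} → y ∈ˡ (x ∷ S) → z ∈ˡ (x ∷ S) →
             Side s y × NonAdj G x y → ¬ (Side s z × NonAdj G x z) → NonAdj G y z
    across (here refl) _           (_ , x≢x , _) _  = contradiction refl x≢x
    across (there _)   (here refl) (_ , xy)      _  = nonAdj-sym G xy
    across {z = z} (there y∈) (there z∈) (y-side , xy) ¬z with side? s z
    ... | no  z-¬side = cross s y∈ z∈ y-side z-¬side
    ... | yes z-side  = (λ { refl → proj₂ xy xz }) , λ yz →
          -- y – z – x – b would be an induced P₄.
          free yz (adj-sym G xz) xb (nonAdj-sym G xy)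
               (cross s z∈ b∈ z-side b-¬side) (cross s y∈ b∈ y-side b-¬side)
      where
      xz : Adj G x z
      xz = ¬nonAdj⇒adj G (x∉ z∈) (λ ¬xz → ¬z (z-side , ¬xz))

  -- If `x` is adjacent to all of `S`, it forms a side of `G` by itself. Otherwise it has a
  -- non-neighbour on one side of the disconnection, and swapping the sides if necessary makes that
  -- side `Side`.
  extend-split : ∀ {G : Graph (Fin n)} {x} → P₄-Free G → (∀ {y} → y ∈ˡ S → x ≢ y) →
                 Split (complement G) S → Split (complement G) (x ∷ S) ⊎ Split G (x ∷ S)
  extend-split {G} {x} free x∉ s with Any.any? (adj? (complement G) x) S
  ... | no none = inj₂ (cone-split {G} (left∈ s)
                         (λ z∈ → ¬nonAdj⇒adj G (x∉ z∈) (λ xz → none (lose z∈ xz))))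
  ... | yes some with find some
  ... | a , a∈ , xa with side? s a
  ...   | yes a-side  = inj₁ (extend-disconnection {G} free x∉ s a∈ a-side xa)
  ...   | no  a-¬side = inj₁ (extend-disconnection {G} free x∉ (swap-split {complement G} s) a∈ a-¬side xa)

module _ {n} {G : Graph (Fin n)} (free : P₄-Free G) where

  -- Induction, adding one vertex at a time. A split of `G` is a disconnection of `complement G`,
  -- which is again `P₄`-free, so one extension step handles both cases.
  P₄-Free⇒split : ∀ x y S → Unique (x ∷ y ∷ S) →
                  Split G (x ∷ y ∷ S) ⊎ Split (complement G) (x ∷ y ∷ S)
  P₄-Free⇒split x y [] ((x≢y All.∷ _) ∷ _) =
    Sum.map (λ xy → cone-split {G = G} (here refl) (λ { (here refl) → xy }))
            (λ xy → cone-split {G = complement G} (here refl) (λ { (here refl) → xy }))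
            (adj-or-nonAdj G x≢y)
  P₄-Free⇒split x y (z ∷ S) (x∉ ∷ unique) with P₄-Free⇒split y z S unique
  ... | inj₂ s = Sum.swap (extend-split {G = G} free (All.lookup x∉) s)
  ... | inj₁ s = Sum.map₁ (map-split {G = complement (complement G)} {G} (complement²⇒adj G))
                   (extend-split {G = complement G} (complement-P₄-Free {G = G} free) (All.lookup x∉)
                     (map-split {G = G} {complement (complement G)} (adj⇒complement² G) s))

-- Whether `u` and `v` are adjacent is left open, so true and false twins are treated alike.
TwinsIn : ∀ {n} → Graph (Fin n) → List (Fin n) → Rel (Fin n) 0ℓ
TwinsIn G S u v = ∀ {w} → w ∈ˡ S → w ≢ u → w ≢ v → Adj G u w ⇔ Adj G v w

HasTwins : ∀ {n} → Graph (Fin n) → List (Fin n) → Set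
HasTwins G S = ∃[ u ] ∃[ v ] (u ∈ˡ S × v ∈ˡ S × u ≢ v × TwinsIn G S u v)

-- `H` stands for `G` or its complement: across a split of either, a vertex of one side sees all
-- vertices of the other alike in `G`. `recurse` is the induction hypothesis.
module _ {n} {G H : Graph (Fin n)} {S : List (Fin n)}
         (homogeneous : ∀ {x y z} → Adj H x z → Adj H y z → Adj G x z ⇔ Adj G y z)
         (unique : Unique S)
         (recurse : ∀ x y T → length (x ∷ y ∷ T) <ᴺ length S → Unique (x ∷ y ∷ T) →
                    HasTwins G (x ∷ y ∷ T))
         where

  open Split

  -- A side with at least two vertices has twins by induction. They remain twins in `S`, because
  -- every vertex of `S` off the side sees the whole side alike.
  side-twins : (s : Split H S) → HasTwins G S ⊎ (∀ {w} → w ∈ˡ S → Side s w → w ≡ left s)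
  side-twins s = go (filter (side? s) S) refl
    where
    go : ∀ T → filter (side? s) S ≡ T → HasTwins G S ⊎ (∀ {w} → w ∈ˡ S → Side s w → w ≡ left s)
    go [] eq with () ← subst (left s ∈ˡ_) eq (∈-filter⁺ (side? s) (left∈ s) (left-side s))
    go (x ∷ []) eq = inj₂ (λ w∈ w-side → trans (≡x w∈ w-side) (sym (≡x (left∈ s) (left-side s))))
      where
      ≡x : ∀ {w} → w ∈ˡ S → Side s w → w ≡ x
      ≡x w∈ w-side with here w≡x ← subst (_ ∈ˡ_) eq (∈-filter⁺ (side? s) w∈ w-side) = w≡x
    go (x ∷ y ∷ T) eq
      with u , v , u∈T , v∈T , u≢v , twins ← recurse x y T
             (subst (λ T → length T <ᴺ length S) eq
               -- `right s` is filtered out, so the side is strictly shorter than `S`.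
               (filter-notAll (side? s) S (lose (right∈ s) (right-¬side s))))
             (subst Unique eq (filter⁺ (side? s) unique))
      = inj₁ (u , v , proj₁ (∈S u∈T) , proj₁ (∈S v∈T) , u≢v , twins-in-S)
      where
      ∈S : ∀ {w} → w ∈ˡ (x ∷ y ∷ T) → w ∈ˡ S × Side s w
      ∈S w∈T = ∈-filter⁻ (side? s) (subst (_ ∈ˡ_) (sym eq) w∈T)

      twins-in-S : TwinsIn G S u v
      twins-in-S {w} w∈ w≢u w≢v with side? s w
      ... | yes w-side  = twins (subst (w ∈ˡ_) eq (∈-filter⁺ (side? s) w∈ w-side)) w≢u w≢v
      ... | no  w-¬side = homogeneous
              (let u∈ , u-side = ∈S u∈T in cross s u∈ w∈ u-side w-¬side)
              (let v∈ , v-side = ∈S v∈T in cross s v∈ w∈ v-side w-¬side)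

  -- When both sides are singletons, `S` has no third vertex and the twin condition is vacuous.
  split-twins : Split H S → HasTwins G S
  split-twins s with side-twins s | side-twins (swap-split s)
  ... | inj₁ twins | _          = twins
  ... | inj₂ _     | inj₁ twins = twins
  ... | inj₂ only-left | inj₂ only-right =
    left s , right s , left∈ s , right∈ s ,
    (λ eq → right-¬side s (subst (Side s) eq (left-side s))) , twins
    where
    twins : TwinsIn G S (left s) (right s)
    twins {w} w∈ w≢left w≢right with side? s w
    ... | yes w-side  = contradiction (only-left w∈ w-side) w≢left
    ... | no  w-¬side = contradiction (only-right w∈ w-¬side) w≢right

module _ {n} {G : Graph (Fin n)} (free : P₄-Free G) where

  -- The recursion is on the length, since a side is a filtered list and not a structural subterm.
  P₄-Free⇒twins : ∀ x y S → Unique (x ∷ y ∷ S) → Acc _<ᴺ_ (length (x ∷ y ∷ S)) →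
                  HasTwins G (x ∷ y ∷ S)
  P₄-Free⇒twins x y S unique (acc rs) with P₄-Free⇒split {G = G} free x y S unique
  ... | inj₁ s = split-twins {G = G} {H = G} (λ xz yz → mk⇔ (λ _ → yz) (λ _ → xz)) unique
                   (λ x′ y′ T shorter u → P₄-Free⇒twins x′ y′ T u (rs shorter)) s
  ... | inj₂ s = split-twins {G = G} {H = complement G}
                   (λ xz yz → mk⇔ (⊥-elim ∘ proj₂ xz) (⊥-elim ∘ proj₂ yz)) unique
                   (λ x′ y′ T shorter u → P₄-Free⇒twins x′ y′ T u (rs shorter)) s

-- Switching a pair of twins

Twins : ∀ {n} → Graph (Fin n) → Rel (Fin n) 0ℓ
Twins G u v = ∀ {w} → w ≢ u → w ≢ v → Adj G u w ⇔ Adj G v w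

-- Any two vertices of an induced `P₄` are told apart by a third, whereas `u` and `v` stay twins in
-- `G′`. So an induced `P₄` of `G′` avoids the pair `uv` and is already present in `G`.
twins-P₄-Free : ∀ {n} {G G′ : Graph (Fin n)} {u v} → u ≢ v → Twins G u v →
                (∀ {x y} → ¬ SamePair u v x y → Adj G x y ⇔ Adj G′ x y) →
                P₄-Free G → P₄-Free G′
twins-P₄-Free {G = G} {G′} {u} {v} u≢v twins same free ab bc cd ac bd ad =
  free (adj a∥b ab) (adj b∥c bc) (adj c∥d cd) (nonAdj a∥c ac) (nonAdj b∥d bd) (nonAdj a∥d ad)
  where
  adj : ∀ {x y} → ¬ SamePair u v x y → Adj G′ x y → Adj G x y
  adj ¬uv = from (same ¬uv)

  nonAdj : ∀ {x y} → ¬ SamePair u v x y → NonAdj G′ x y → NonAdj G x y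
  nonAdj ¬uv (x≢y , ¬xy) = x≢y , ¬xy ∘ to (same ¬uv)

  u-pair : ∀ {w} → w ≢ v → ¬ SamePair u v u w
  u-pair w≢v (inj₁ (_ , w≡v)) = w≢v w≡v
  u-pair w≢v (inj₂ (u≡v , _)) = u≢v u≡v

  v-pair : ∀ {w} → w ≢ u → ¬ SamePair u v v w
  v-pair w≢u (inj₁ (v≡u , _)) = u≢v (sym v≡u)
  v-pair w≢u (inj₂ (_ , w≡u)) = w≢u w≡u

  twins′ : ∀ {w} → w ≢ u → w ≢ v → Adj G′ u w ⇔ Adj G′ v w
  twins′ w≢u w≢v = mk⇔
    (to (same (v-pair w≢u)) ∘ to (twins w≢u w≢v) ∘ from (same (u-pair w≢v)))
    (to (same (u-pair w≢v)) ∘ from (twins w≢u w≢v) ∘ from (same (v-pair w≢u)))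

  distinguished : ∀ {x y z} → Adj G′ x z → NonAdj G′ y z → ¬ SamePair u v x y
  distinguished xz (y≢z , ¬yz) (inj₁ (refl , refl)) =
    ¬yz (to (twins′ (≢-sym (adj⇒≢ G′ xz)) (≢-sym y≢z)) xz)
  distinguished xz (y≢z , ¬yz) (inj₂ (refl , refl)) =
    ¬yz (from (twins′ (≢-sym y≢z) (≢-sym (adj⇒≢ G′ xz))) xz)

  -- The distinguishing vertices are c for ab, d for ac, b for ad, a for bc, a for bd and b for cd.
  a∥b = distinguished bc ac ∘ samePair-sym u v
  a∥c = distinguished cd ad ∘ samePair-sym u v
  a∥d = distinguished ab (nonAdj-sym G′ bd)
  b∥c = distinguished (adj-sym G′ ab) (nonAdj-sym G′ ac)
  b∥d = distinguished (adj-sym G′ ab) (nonAdj-sym G′ ad)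
  c∥d = distinguished (adj-sym G′ bc) (nonAdj-sym G′ bd)

P₄-saturated-impossible : ∀ n → 2 ≤ n → (G : Graph (Fin n)) → ¬ InducedSaturated ⟨P₄⟩ G
P₄-saturated-impossible n@(2+ _) (s≤s (s≤s _)) G (¬contains , delete , add)
  with free ← (λ {a b c d} → ¬contains⇒P₄-Free {G = G} {𝓕 = ⟨P₄⟩} refl ¬contains {a} {b} {c} {d})
  -- The list of all vertices is used, so the twins found relative to it are twins in the whole
  -- graph.
  with u , v , _ , _ , u≢v , twins ← P₄-Free⇒twins {G = G} free _ _ _ (allFin⁺ n) (<-wellFounded _)
  with adj-or-nonAdj G u≢v
... | inj₁ uv = P₄-Free⇒¬contains {G = deleteEdge G u v}
  (twins-P₄-Free {G = G} {deleteEdge G u v} u≢v (twins (∈-allFin _)) (λ ¬uv → mk⇔ (_, ¬uv) proj₁) free)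
  (delete u v uv)
... | inj₂ uv = P₄-Free⇒¬contains {G = addEdge G u v (proj₁ uv)}
  (twins-P₄-Free {G = G} {addEdge G u v (proj₁ uv)} u≢v (twins (∈-allFin _))
    (λ ¬uv → mk⇔ inj₁ Sum.[ id , ⊥-elim ∘ ¬uv ]) free)
  (add u v uv)

-- Nested closed neighbourhoods

Closed : ∀ {n} → Graph (Fin n) → Rel (Fin n) 0ℓ
Closed G x w = x ≡ w ⊎ Adj G x w

-- This inclusion `N[x] ⊆ N[y]` is only a preorder, as adjacent twins have equal closed
-- neighbourhoods. Since `x` lies in `N[x]`, it makes `x` and `y` equal or adjacent.
Below : ∀ {n} → Graph (Fin n) → Rel (Fin n) 0ℓ
Below G x y = ∀ w → Closed G x w → Closed G y w

module _ {n} (G : Graph (Fin n)) where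

  closed? : Decidable₂ (Closed G)
  closed? x w = (x ≟ w) ⊎-dec adj? G x w

  below? : Decidable₂ (Below G)
  below? x y = all? (λ w → closed? x w →-dec closed? y w)

  below-trans : Transitive (Below G)
  below-trans x≼y y≼z w = y≼z w ∘ x≼y w

  ¬closed⇒nonAdj : ∀ {x y} → ¬ Closed G x y → NonAdj G x y
  ¬closed⇒nonAdj ¬xy = ¬xy ∘ inj₁ , ¬xy ∘ inj₂

  ¬below⇒witness : ∀ {x y} → ¬ Below G x y → ∃[ w ] (Closed G x w × ¬ Closed G y w)
  ¬below⇒witness {x} {y} x⋠y
    with w , h ← ¬∀⟶∃¬ n _ (λ w → closed? x w →-dec closed? y w) x⋠y =
    w , decidable-stable (closed? x w) (λ ¬xw → h (⊥-elim ∘ ¬xw)) , λ yw → h (λ _ → yw)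

  ¬closed⇒adj : ∀ {x y z} → Adj G x y → Closed G y z → ¬ Closed G x z → Adj G y z
  ¬closed⇒adj xy (inj₁ refl) ¬xz = contradiction (inj₂ xy) ¬xz
  ¬closed⇒adj xy (inj₂ yz)   _   = yz

  -- If a lies in `N[b]` but not `N[c]`, and d in `N[c]` but not `N[b]`, then a - b - c - d is the
  -- forbidden pattern.
  P₄C₄-Free⇒nested : P₄C₄-Free G → ∀ {b c} → Adj G b c → Below G b c ⊎ Below G c b
  P₄C₄-Free⇒nested free {b} {c} bc with below? c b
  ... | yes c≼b = inj₂ c≼b
  ... | no  c⋠b with d , cd , ¬bd ← ¬below⇒witness c⋠b =
    inj₁ λ a ba → decidable-stable (closed? c a) λ ¬ca →
      free (adj-sym G (¬closed⇒adj (adj-sym G bc) ba ¬ca)) bc (¬closed⇒adj bc cd ¬bd)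
           (nonAdj-sym G (¬closed⇒nonAdj ¬ca)) (¬closed⇒nonAdj ¬bd)

  -- In the forbidden pattern the middle edge `bc` is not nested: `a` and `d` witness the failure of
  -- the two inclusions.
  nested⇒P₄C₄-Free : (∀ {b c} → Adj G b c → Below G b c ⊎ Below G c b) → P₄C₄-Free G
  nested⇒P₄C₄-Free nested {a} {d = d} ab bc cd (a≢c , ¬ac) (b≢d , ¬bd) with nested bc
  ... | inj₁ b≼c = Sum.[ ≢-sym a≢c , ¬ac ∘ adj-sym G ] (b≼c a (inj₂ (adj-sym G ab)))
  ... | inj₂ c≼b = Sum.[ b≢d , ¬bd ] (c≼b d (inj₂ cd))

-- Modifying {P₄, C₄}-free graphs

module _ {n} {G : Graph (Fin n)} (free : P₄C₄-Free G) where

  -- Only `N[u]` and `N[y]` grow, by `y` and `u` respectively. An inclusion `N[u] ⊆ N[c]` for an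
  -- edge `uc` survives because `c` is also adjacent to `y`. An inclusion `N[y] ⊆ N[c]` survives if
  -- `c` is adjacent to `u`, and is otherwise reversed by maximality.
  addEdge-P₄C₄-Free : ∀ {u y} (uy : NonAdj G u y) → (∀ {w} → Adj G u w → Adj G y w) →
                      (∀ {z} → NonAdj G u z → (∀ {w} → Adj G u w → Adj G z w) →
                               Below G y z → Below G z y) →
                      P₄C₄-Free (addEdge G u y (proj₁ uy))
  addEdge-P₄C₄-Free {u} {y} (u≢y , ¬uy) N⟨u⟩⊆N⟨y⟩ maximal = nested⇒P₄C₄-Free G′ nested′
    where
    G′ = addEdge G u y u≢y

    lift : ∀ {b c} → (∀ {w} → SamePair u y b w → Closed G′ c w) → Below G b c → Below G′ b c
    lift new b≼c w (inj₁ b≡w)       = Sum.map₂ inj₁ (b≼c w (inj₁ b≡w))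
    lift new b≼c w (inj₂ (inj₁ bw)) = Sum.map₂ inj₁ (b≼c w (inj₂ bw))
    lift new b≼c w (inj₂ (inj₂ uy)) = new uy

    preserved : ∀ {b c} → Adj G b c → Below G b c → Below G′ b c ⊎ Below G′ c b
    preserved {b} {c} bc b≼c with b ≟ u | b ≟ y
    ... | no b≢u | no b≢y =
      inj₁ (lift (λ { (inj₁ (b≡u , _)) → contradiction b≡u b≢u
                    ; (inj₂ (b≡y , _)) → contradiction b≡y b≢y }) b≼c)
    ... | yes refl | _ =
      inj₁ (lift (λ { (inj₁ (_ , refl)) → inj₂ (inj₁ (adj-sym G (N⟨u⟩⊆N⟨y⟩ bc)))
                    ; (inj₂ (u≡y , _))  → contradiction u≡y u≢y }) b≼c)
    ... | no b≢u | yes refl with adj? G u c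
    ...   | yes uc =
      inj₁ (lift (λ { (inj₁ (b≡u , _))  → contradiction b≡u b≢u
                    ; (inj₂ (_ , refl)) → inj₂ (inj₁ (adj-sym G uc)) }) b≼c)
    -- Here `c` competes with `y`: it is a non-neighbour of `u` with `N(u) ⊆ N(c)`, so maximality of
    -- `y` gives `N[c] ⊆ N[y]`.
    ...   | no ¬uc =
      inj₂ (lift (λ { (inj₁ (refl , _)) → contradiction (adj-sym G bc) ¬uy
                    ; (inj₂ (refl , _)) → ⊥-elim (adj-irrefl G refl bc) })
                 (maximal ((λ { refl → ¬uy (adj-sym G bc) }) , ¬uc) N⟨u⟩⊆N⟨c⟩ b≼c))
      where
      N⟨u⟩⊆N⟨c⟩ : ∀ {w} → Adj G u w → Adj G c w
      N⟨u⟩⊆N⟨c⟩ {w} uw with b≼c w (inj₂ (N⟨u⟩⊆N⟨y⟩ uw))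
      ... | inj₁ refl = contradiction uw ¬uc
      ... | inj₂ cw   = cw

    u≼y : Below G′ u y
    u≼y w (inj₁ refl)                     = inj₂ (inj₂ (inj₂ (refl , refl)))
    u≼y w (inj₂ (inj₁ uw))                = inj₂ (inj₁ (N⟨u⟩⊆N⟨y⟩ uw))
    u≼y w (inj₂ (inj₂ (inj₁ (_ , refl)))) = inj₁ refl
    u≼y w (inj₂ (inj₂ (inj₂ (u≡y , _))))  = contradiction u≡y u≢y

    nested′ : ∀ {b c} → Adj G′ b c → Below G′ b c ⊎ Below G′ c b
    nested′ (inj₂ (inj₁ (refl , refl))) = inj₁ u≼y
    nested′ (inj₂ (inj₂ (refl , refl))) = inj₂ u≼y
    nested′ (inj₁ bc) with P₄C₄-Free⇒nested G free bc
    ... | inj₁ b≼c = preserved bc b≼c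
    ... | inj₂ c≼b = Sum.swap (preserved (adj-sym G bc) c≼b)

  -- A forbidden pattern created by the deletion has `uv` as one of its diagonals `ac`, `bd`. The
  -- ends of the other diagonal are then neighbours of `u` and `v`, hence adjacent by the clique
  -- hypothesis, a contradiction.
  deleteEdge-P₄C₄-Free : ∀ {u v} →
                         (∀ {x y} → Adj G u x ⊎ Adj G v x → Adj G u y ⊎ Adj G v y → x ≢ y → Adj G x y) →
                         P₄C₄-Free (deleteEdge G u v)
  deleteEdge-P₄C₄-Free {u} {v} clique = free′
    where
    G′ = deleteEdge G u v

    -- If both diagonals were the pair `uv`, then `ab` would be a loop or the deleted edge.
    pairs-meet : ∀ {a b c d} → SamePair u v a c → SamePair u v b d → a ≡ b ⊎ SamePair u v a b
    pairs-meet (inj₁ (refl , _)) (inj₁ (refl , _)) = inj₁ refl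
    pairs-meet (inj₁ (refl , _)) (inj₂ (refl , _)) = inj₂ (inj₁ (refl , refl))
    pairs-meet (inj₂ (refl , _)) (inj₁ (refl , _)) = inj₂ (inj₂ (refl , refl))
    pairs-meet (inj₂ (refl , _)) (inj₂ (refl , _)) = inj₁ refl

    neighbours : ∀ {a b c d} → SamePair u v a c → Adj G a b → Adj G c d →
                 (Adj G u b ⊎ Adj G v b) × (Adj G u d ⊎ Adj G v d)
    neighbours (inj₁ (refl , refl)) ab cd = inj₁ ab , inj₂ cd
    neighbours (inj₂ (refl , refl)) ab cd = inj₂ ab , inj₁ cd

    ¬deleted-diagonal : ∀ {a b c d} → SamePair u v a c → Adj G′ a b → Adj G′ c d → ¬ NonAdj G′ b d
    ¬deleted-diagonal ac (ab , ab≢uv) (cd , _) (b≢d , ¬bd) =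
      let ub , ud = neighbours ac ab cd in
      ¬bd (clique ub ud b≢d , λ bd → Sum.[ adj⇒≢ G ab , ab≢uv ] (pairs-meet ac bd))

    free′ : P₄C₄-Free G′
    free′ {a} {b} {c} {d} ab bc cd ac bd with samePair? u v a c | samePair? u v b d
    ... | yes ac≡uv | _         = ¬deleted-diagonal ac≡uv ab cd bd
    ... | no  _     | yes bd≡uv = ¬deleted-diagonal bd≡uv (adj-sym G′ ab) (adj-sym G′ cd) ac
    ... | no  ac≢uv | no  bd≢uv =
      free (proj₁ ab) (proj₁ bc) (proj₁ cd)
           (proj₁ ac , λ e → proj₂ ac (e , ac≢uv)) (proj₁ bd , λ e → proj₂ bd (e , bd≢uv))

-- Minimal elements of preorders on finite sets

module _ {n} {_≼_ : Rel (Fin n) 0ℓ} (≼-trans : Transitive _≼_) (_≼?_ : Decidable₂ _≼_) where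

  private
    _≺_ : Rel (Fin n) 0ℓ
    x ≺ y = x ≼ y × ¬ y ≼ x

    ≺-isStrictPartialOrder : IsStrictPartialOrder _≡_ _≺_
    ≺-isStrictPartialOrder = record
      { isEquivalence = isEquivalence
      ; irrefl        = λ { refl (x≼x , x⋠x) → x⋠x x≼x }
      ; trans         = λ (x≼y , y⋠x) (y≼z , _) → ≼-trans x≼y y≼z , λ z≼x → y⋠x (≼-trans y≼z z≼x)
      ; <-resp-≈      = (λ { refl → id }) , (λ { refl → id })
      }

  -- The strict part of the preorder is well-founded on a finite set, so descending from `x` within
  -- `P` stops. Minimality is up to equivalence.
  minimal : ∀ {P : Fin n → Set} → Decidable P → ∀ {x} → P x →
            ∃[ m ] (P m × (∀ {y} → P y → y ≼ m → m ≼ y))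
  minimal {P} P? = go (spo-wellFounded ≺-isStrictPartialOrder _)
    where
    go : ∀ {x} → Acc _≺_ x → P x → ∃[ m ] (P m × (∀ {y} → P y → y ≼ m → m ≼ y))
    go {x} (acc rs) px with any? (λ y → P? y ×-dec ((y ≼? x) ×-dec ¬? (x ≼? y)))
    ... | yes (y , py , y≺x) = go (rs y≺x) py
    ... | no  none = x , px , λ {y} py y≼x →
          decidable-stable (x ≼? y) (λ x⋠y → none (y , py , y≼x , x⋠y))

-- Finding an edge to delete or a non-edge to add

Deletable : ∀ {n} → Graph (Fin n) → Rel (Fin n) 0ℓ
Deletable G u v =
  Adj G u v × (∀ {x y} → Adj G u x ⊎ Adj G v x → Adj G u y ⊎ Adj G v y → x ≢ y → Adj G x y)

Dominated : ∀ {n} → Graph (Fin n) → Rel (Fin n) 0ℓ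
Dominated G u y = NonAdj G u y × (∀ w → Adj G u w → Adj G y w)

another : ∀ {m} (u : Fin (2 + m)) → ∃[ y ] u ≢ y
another zero    = suc zero , λ ()
another (suc _) = zero , λ ()

module _ {m} {G : Graph (Fin (2 + m))} (free : P₄C₄-Free G) where

  -- With `N[u]` minimal and `v` a neighbour of `u` minimal among its neighbours, either
  -- `N[v] ⊆ N[u]`, or any vertex of `N[v]` outside `N[u]` is adjacent to all of `N(u)`.
  deletable-or-dominated : (∃[ u ] ∃[ v ] Deletable G u v) ⊎ (∃[ u ] ∃[ y ] Dominated G u y)
  deletable-or-dominated
    with u , _ , u-min ← minimal (below-trans G) (below? G) {λ _ → ⊤} (λ _ → yes tt) {zero} tt
    with any? (adj? G u)
  -- `N(u)` is empty, so any other vertex dominates `u`.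
  ... | no isolated =
    let y , u≢y = another u
    in inj₂ (u , y , (u≢y , λ uy → isolated (y , uy)) , λ w uw → contradiction (w , uw) isolated)
  ... | yes (_ , uv₀)
    with v , uv , v-min ← minimal (below-trans G) (below? G) (adj? G u) uv₀
    with below? G v u
  -- All neighbours of `u` and `v` lie in `N[u]`, which is contained in `N[x]` for each of its
  -- members `x` and so is a clique.
  ... | yes v≼u = inj₁ (u , v , uv , λ ux uy x≢y →
          Sum.[ (λ x≡y → contradiction x≡y x≢y) , id ] (u≼ (closed ux) _ (closed uy)))
    where
    u≼ : ∀ {x} → Closed G u x → Below G u x
    u≼ (inj₁ refl) = λ _ → id
    u≼ (inj₂ ux)   = Sum.[ id , u-min tt ] (P₄C₄-Free⇒nested G free ux)

    closed : ∀ {x} → Adj G u x ⊎ Adj G v x → Closed G u x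
    closed = Sum.[ inj₂ , v≼u _ ∘ inj₂ ]
  ... | no v⋠u with y , vy , ¬uy ← ¬below⇒witness G v⋠u =
    inj₂ (u , y , ¬closed⇒nonAdj G ¬uy , λ w uw → adj-sym G (¬closed⇒adj G uw (v≼ uw y vy) ¬uy))
    where
    u≼ : ∀ {w} → Adj G u w → Below G u w
    u≼ uw = Sum.[ id , u-min tt ] (P₄C₄-Free⇒nested G free uw)

    v≼ : ∀ {w} → Adj G u w → Below G v w
    v≼ {w} uw with u≼ uw v (inj₂ uv)
    ... | inj₁ refl = λ _ → id
    ... | inj₂ wv   = Sum.[ v-min uw , id ] (P₄C₄-Free⇒nested G free wv)

P₄C₄-saturated-impossible : ∀ n → 2 ≤ n → (G : Graph (Fin n)) → ¬ InducedSaturated ⟨P₄,C₄⟩ G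
P₄C₄-saturated-impossible (2+ _) (s≤s (s≤s _)) G (¬contains , delete , add)
  with free ← (λ {a b c d} → ¬contains⇒P₄C₄-Free {G = G} ¬contains {a} {b} {c} {d})
  with deletable-or-dominated {G = G} free
... | inj₁ (u , v , uv , clique) =
  P₄C₄-Free⇒¬contains {G = deleteEdge G u v} (deleteEdge-P₄C₄-Free {G = G} free clique) (delete u v uv)
... | inj₂ (u , _ , dominated)
  with y , (uy , N⟨u⟩⊆N⟨y⟩) , maximal ←
         -- The preorder is reversed, so `minimal` returns a dominating `y` with `N[y]` maximal.
         minimal (λ x≽y y≽z → below-trans G y≽z x≽y) (flip (below? G))
           (λ y → adj? (complement G) u y ×-dec all? (λ w → adj? G u w →-dec adj? G y w)) dominated =
  P₄C₄-Free⇒¬contains {G = addEdge G u y (proj₁ uy)}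
    (addEdge-P₄C₄-Free {G = G} free uy (N⟨u⟩⊆N⟨y⟩ _)
      (λ uz N⟨u⟩⊆N⟨z⟩ → maximal (uz , λ _ → N⟨u⟩⊆N⟨z⟩)))
    (add u y uy)

theorem19 : (∀ (n : ℕ) → 2 ≤ n → (G : Graph (Fin n)) → ¬ InducedSaturated ⟨P₄⟩ G)
    × (∀ (n : ℕ) → 2 ≤ n → (G : Graph (Fin n)) → ¬ InducedSaturated ⟨P₄,C₄⟩ G)
theorem19 = P₄-saturated-impossible , P₄C₄-saturated-impossible
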